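{- For weighted formulas, the proof system consisting of Axiom (A), Rules (R1)–(R5), and Rule (R6w) (in place of (R6)) is sound and complete: for every finite set $\Gamma$ of sentences and every sentence $\gamma$ (with weighted formulas as components), $\Gamma\vdash\gamma$ if and only if $\Gamma\models\gamma$.
   Context: Weighted setting. Fix a finite set of atomic propositions, finite sets of binary and unary connectives; each binary $\alpha$ has an arbitrary function $f_\alpha:[0,1]^2\times\mathbb R^2\to[0,1]$ and each unary $\rho$ an arbitrary $f_\rho:[0,1]\times\mathbb R\to[0,1]$. Weighted formulas: atoms are formulas; if $\sigma_1,\sigma_2,\sigma$ are formulas and $w_1,w_2,w\in\mathbb R$ are weights, then $(\sigma_1\,\alpha\,\sigma_2,w_1,w_2)$ and $(\rho\sigma,w)$ are formulas; their subformulas are $\sigma_1,\sigma_2$ resp. $\sigma$. A model assigns values in $[0,1]$ to atoms; the value of $(\sigma_1\,\alpha\,\sigma_2,w_1,w_2)$ is $f_\alpha(s_1,s_2,w_1,w_2)$ and of $(\rho\sigma,w)$ is $f_\rho(s,w)$, where $s_1,s_2,s$ are the values of $\sigma_1,\sigma_2,\sigma$. A sentence $(\sigma_1,\ldots,\sigma_k,S)$ has pairwise distinct formulas and $S\subseteq[0,1]^k$; $M$ satisfies it iff the tuple of values of the $\sigma_i$ lies in $S$. $\Gamma\models\gamma$: every model of all of $\Gamma$ is a model of $\gamma$; $\Gamma\vdash\gamma$: $\gamma$ derivable from $\Gamma$ by: (A) $(\sigma,[0,1])$ for every formula $\sigma$. (R1) For a permutation $\pi$: from $(\sigma_1,\ldots,\sigma_k,S)$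 infer $(\sigma_{\pi(1)},\ldots,\sigma_{\pi(k)},\{(s_{\pi(1)},\ldots,s_{\pi(k)}):(s_1,\ldots,s_k)\in S\})$. (R2) From $(\sigma_1,\ldots,\sigma_k,S)$ infer $(\sigma_1,\ldots,\sigma_m,S\times[0,1]^{m-k})$ (components kept distinct). (R3) From $(\sigma_1,\ldots,\sigma_k,S_1)$ and $(\sigma_1,\ldots,\sigma_k,S_2)$ infer $(\sigma_1,\ldots,\sigma_k,S_1\cap S_2)$. (R4) For $0<r<k$: from $(\sigma_1,\ldots,\sigma_k,S)$ infer $(\sigma_1,\ldots,\sigma_{k-r},\{(s_1,\ldots,s_{k-r}):(s_1,\ldots,s_k)\in S\})$. (R5) From $(\sigma_1,\ldots,\sigma_k,S)$ infer $(\sigma_1,\ldots,\sigma_k,S')$ whenever $S\subseteq S'\subseteq[0,1]^k$. (R6w) From $(\sigma_1,\ldots,\sigma_k,S)$ infer $(\sigma_1,\ldots,\sigma_k,S')$, where $S'$ is the set of $(s_1,\ldots,s_k)\in S$ such that $f_\alpha(s_i,s_j,w_1,w_2)=s_m$ whenever $\sigma_m$ is $(\sigma_i\,\alpha\,\sigma_j,w_1,w_2)$, and $f_\rho(s_i,w)=s_j$ whenever $\sigma_j$ is $(\rho\sigma_i,w)$. -}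

module Defs where

open import Axiom.Extensionality.Propositional using (Extensionality)
open import Data.Bool using (Bool; true; false; T)
open import Data.Empty using (⊥-elim)
open import Data.Fin using (Fin)
open import Data.Fin.Permutation using (Permutation′; _⟨$⟩ʳ_)
open import Data.List using (List)
open import Data.List.Membership.Propositional using () renaming (_∈_ to _∈ˡ_)
open import Data.List.Relation.Unary.All using (All)
open import Data.Nat using (ℕ; suc)
open import Data.Product using (∃; _×_; _,_)
open import Data.Rational using (ℚ; 0ℚ; 1ℚ; _+_; _-_; -_; _<_; _<?_)
open import Data.Rational.Properties
  using (<-trans; <-irrefl; <-dense; +-monoʳ-<; +-identityʳ)
open import Data.Unit using (tt)
open import Data.Vec using (Vec; [_]; _++_; lookup; map; tabulate; take)
open import Data.Vec.Relation.Unary.Unique.Propositional using (Unique)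
open import Level using (0ℓ)
open import Relation.Binary.PropositionalEquality using (_≡_; refl; subst)
open import Relation.Nullary using (¬_)
open import Relation.Nullary.Decidable using (⌊_⌋; toWitness; fromWitness)
open import Relation.Unary using (Pred; _∈_; _⊆_; _∩_; U)

-- Real numbers as Dedekind cuts: nonempty proper down-closed subsets of ℚ
-- without a largest element.  A cut is given by its characteristic function
-- and the cut conditions are irrelevant, so that two reals are equal (_≡_)
-- exactly when their characteristic functions are; see ≤-antisym.
record ℝ : Set where
  constructor cut
  field
    lower      : ℚ → Bool
    .inhabited : ∃ λ q → T (lower q)
    .proper    : ∃ λ q → ¬ T (lower q)
    .closed    : ∀ {p q} → p < q → T (lower q) → T (lower p)
    .open′     : ∀ {p} → T (lower p) → ∃ λ q → p < q × T (lower q)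

open ℝ using (lower)

infix 4 _≤_

_≤_ : ℝ → ℝ → Set
x ≤ y = ∀ q → T (lower x q) → T (lower y q)

≤-antisym : Extensionality 0ℓ 0ℓ → ∀ {x y} → x ≤ y → y ≤ x → x ≡ y
≤-antisym ext {x} {y} x≤y y≤x =
  same (ext λ q → T-≡ (lower x q) (lower y q) (x≤y q) (y≤x q))
  where
  same : ∀ {x y} → lower x ≡ lower y → x ≡ y
  same refl = refl

  T-≡ : ∀ a b → (T a → T b) → (T b → T a) → a ≡ b
  T-≡ true  true  _ _ = refl
  T-≡ true  false f _ = ⊥-elim (f tt)
  T-≡ false true  _ g = ⊥-elim (g tt)
  T-≡ false false _ _ = refl

fromℚ : ℚ → ℝ
fromℚ q = cut (λ p → ⌊ p <? q ⌋)
  (q - 1ℚ , fromWitness (shift (toWitness {a? = (- 1ℚ) <? 0ℚ} tt)))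
  (q , λ q<q → <-irrefl refl (toWitness q<q))
  (λ p<r r<q → fromWitness (<-trans p<r (toWitness r<q)))
  λ p<q → let (r , p<r , r<q) = <-dense (toWitness p<q)
          in r , p<r , fromWitness r<q
  where
  shift : ∀ {r} → r < 0ℚ → q + r < q
  shift {r} r<0 = subst (q + r <_) (+-identityʳ q) (+-monoʳ-< q r<0)

-- The unit interval [0,1].
record 𝕀 : Set where
  constructor unit
  field
    value : ℝ
    .0≤   : fromℚ 0ℚ ≤ value
    .≤1   : value ≤ fromℚ 1ℚ

record Logic : Set where
  field
    #atoms #binary #unary : ℕ
    f₂ : Fin #binary → 𝕀 → 𝕀 → ℝ → ℝ → 𝕀
    f₁ : Fin #unary → 𝕀 → ℝ → 𝕀

permute : ∀ {a} {A : Set a} {k} → Permutation′ k → Vec A k → Vec A k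
permute π xs = tabulate λ i → lookup xs (π ⟨$⟩ʳ i)

module _ (𝓛 : Logic) where
  open Logic 𝓛

  data Formula : Set where
    atom   : Fin #atoms → Formula
    binary : Fin #binary → (σ₁ σ₂ : Formula) (w₁ w₂ : ℝ) → Formula
    unary  : Fin #unary → (σ : Formula) (w : ℝ) → Formula

  Model : Set
  Model = Fin #atoms → 𝕀

  -- Sentences have at least one component.  Irrelevance of the distinctness
  -- proof makes a sentence determined by its components and its set.
  record Sentence : Set₁ where
    constructor sentence
    field
      {n}       : ℕ
      formulas  : Vec Formula (suc n)
      .distinct : Unique formulas
      values    : Pred (Vec 𝕀 (suc n)) 0ℓ

module _ {𝓛 : Logic} where
  open Logic 𝓛

  ⟦_⟧ : Formula 𝓛 → Model 𝓛 → 𝕀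
  ⟦ atom a               ⟧ M = M a
  ⟦ binary α σ₁ σ₂ w₁ w₂ ⟧ M = f₂ α (⟦ σ₁ ⟧ M) (⟦ σ₂ ⟧ M) w₁ w₂
  ⟦ unary ρ σ w          ⟧ M = f₁ ρ (⟦ σ ⟧ M) w

  infix 4 _⊩_ _⊨_ _⊢_

  _⊩_ : Model 𝓛 → Sentence 𝓛 → Set
  M ⊩ sentence σs _ S = map (λ σ → ⟦ σ ⟧ M) σs ∈ S

  _⊨_ : List (Sentence 𝓛) → Sentence 𝓛 → Set₁
  Γ ⊨ γ = ∀ M → All (M ⊩_) Γ → M ⊩ γ

  -- The tuples in [0,1]ᵏ that respect the connectives among σ₁, …, σₖ.
  Respects : ∀ {k} → Vec (Formula 𝓛) k → Pred (Vec 𝕀 k) 0ℓ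
  Respects σs s =
    (∀ m i j α w₁ w₂ →
       lookup σs m ≡ binary α (lookup σs i) (lookup σs j) w₁ w₂ →
       f₂ α (lookup s i) (lookup s j) w₁ w₂ ≡ lookup s m)
    × (∀ j i ρ w →
         lookup σs j ≡ unary ρ (lookup σs i) w →
         f₁ ρ (lookup s i) w ≡ lookup s j)

  data _⊢_ (Γ : List (Sentence 𝓛)) : Sentence 𝓛 → Set₁ where
    hyp : ∀ {γ} → γ ∈ˡ Γ → Γ ⊢ γ

    A   : ∀ σ .(d : Unique [ σ ]) → Γ ⊢ sentence [ σ ] d U

    R1  : ∀ {n} {σs : Vec (Formula 𝓛) (suc n)} {S} .{d : Unique σs}
          (π : Permutation′ (suc n)) .(d′ : Unique (permute π σs)) →
          Γ ⊢ sentence σs d S →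
          Γ ⊢ sentence (permute π σs) d′ (λ t → ∃ λ s → s ∈ S × t ≡ permute π s)

    R2  : ∀ {n r} {σs : Vec (Formula 𝓛) (suc n)} {S} .{d : Unique σs}
          (τs : Vec (Formula 𝓛) r) .(d′ : Unique (σs ++ τs)) →
          Γ ⊢ sentence σs d S →
          Γ ⊢ sentence (σs ++ τs) d′ (λ t → take (suc n) t ∈ S)

    R3  : ∀ {n} {σs : Vec (Formula 𝓛) (suc n)} {S₁ S₂} .{d : Unique σs} →
          Γ ⊢ sentence σs d S₁ →
          Γ ⊢ sentence σs d S₂ →
          Γ ⊢ sentence σs d (S₁ ∩ S₂)

    R4  : ∀ {n r} (σs : Vec (Formula 𝓛) (suc n)) (τs : Vec (Formula 𝓛) (suc r))
          {S} .{d : Unique (σs ++ τs)} .(d′ : Unique σs) →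
          Γ ⊢ sentence (σs ++ τs) d S →
          Γ ⊢ sentence σs d′ (λ s → ∃ λ t → s ++ t ∈ S)

    R5  : ∀ {n} {σs : Vec (Formula 𝓛) (suc n)} {S S′} .{d : Unique σs} →
          S ⊆ S′ →
          Γ ⊢ sentence σs d S →
          Γ ⊢ sentence σs d S′

    R6w : ∀ {n} {σs : Vec (Formula 𝓛) (suc n)} {S} .{d : Unique σs} →
          Γ ⊢ sentence σs d S →
          Γ ⊢ sentence σs d (S ∩ Respects σs)

{-# OPTIONS --safe #-}
-- Soundness is an induction on derivations.  For completeness, list all
-- subformulas of Γ and γ in one vector of pairwise distinct formulas.  Every
-- hypothesis can be extended to this vector, the extensions intersected, and
-- (R6w) applied.  A tuple that survives assigns to each formula the value it
-- has in the model read off at the atoms; that model satisfies Γ, hence γ, and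
-- the projection to the formulas of γ derives γ.
module Submission where

open import Defs
open import Axiom.ExcludedMiddle using (ExcludedMiddle)
open import Data.Fin using (Fin; zero; suc; _↑ˡ_; punchIn; punchOut)
open import Data.Fin.Permutation
  using (Permutation; _⟨$⟩ʳ_; _⟨$⟩ˡ_; id; flip; insert; insert-punchIn; cast-id; _∘ₚ_;
         inverseˡ; inverseʳ; ↔⇒≡)
open import Data.Fin.Properties
  using (_≟_; 0≢1+n; toℕ-injective; toℕ-cast; toℕ-↑ˡ; punchIn-punchOut; punchOut-injective)
  renaming (suc-injective to Fin-suc-injective)
open import Data.List as List using (List; []; _∷_; concatMap; deduplicate)
open import Data.List.Membership.Propositional using (lose; find) renaming (_∈_ to _∈ˡ_)
open import Data.List.Membership.Propositional.Properties
  using (∈-deduplicate⁺; ∈-deduplicate⁻; ∈-concatMap⁺; ∈-concatMap⁻)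
  renaming (∈-++⁺ˡ to ∈ˡ-++⁺ˡ; ∈-++⁺ʳ to ∈ˡ-++⁺ʳ; ∈-++⁻ to ∈ˡ-++⁻)
open import Data.List.Relation.Unary.All as All using (All; []; _∷_)
open import Data.List.Relation.Unary.AllPairs using ([]; _∷_)
open import Data.List.Relation.Unary.Any using (here; there)
import Data.List.Relation.Unary.Unique.DecPropositional.Properties as Dedup
import Data.List.Relation.Unary.Unique.Propositional as List
open import Data.Nat using (ℕ; zero; suc; _+_)
open import Data.Nat.Properties using (suc-injective; +-identityʳ)
open import Data.Product using (∃; _×_; _,_)
open import Data.Sum using (inj₁; inj₂)
open import Data.Unit using (tt)
open import Data.Vec
  using (Vec; []; _∷_; _++_; lookup; map; tabulate; take; drop; toList; fromList)
open import Data.Vec.Membership.Propositional using () renaming (_∈_ to _∈ᵛ_)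
open import Data.Vec.Membership.Propositional.Properties
  using (∈-lookup; ∈-toList⁺; ∈-fromList⁺; ∈-fromList⁻)
open import Data.Vec.Properties
  using (lookup-map; lookup∘tabulate; tabulate∘lookup; tabulate-∘; tabulate-cong;
         take++drop≡id; map-++; ++-injectiveˡ)
open import Data.Vec.Relation.Unary.All using ([])
open import Data.Vec.Relation.Unary.All.Properties using (fromList⁺)
open import Data.Vec.Relation.Unary.AllPairs using ([]; _∷_)
open import Data.Vec.Relation.Unary.Any using (index)
open import Data.Vec.Relation.Unary.Any.Properties using (lookup-index)
open import Data.Vec.Relation.Unary.Unique.Propositional using (Unique)
open import Data.Vec.Relation.Unary.Unique.Propositional.Properties
  using (tabulate⁺; lookup-injective)
open import Function.Base using (_∘_)
open import Function.Bundles using (_⇔_; mk⇔; module Injection)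
open import Function.Definitions using (Injective)
open import Function.Properties.Inverse using (↔⇒↣)
open import Level using (0ℓ)
open import Relation.Binary.Definitions using (DecidableEquality)
open import Relation.Binary.PropositionalEquality
  using (_≡_; _≢_; refl; sym; trans; cong; cong₂; subst)
open import Relation.Nullary using (yes; no; contradiction)
open import Relation.Nullary.Decidable using (recompute)
open import Relation.Unary using (_∈_; _∩_)

private
  variable
    a : Level.Level
    X Y : Set a
    k m n r : ℕ

-- Injections of finite index sets and the selections of coordinates they induce.

-- (R2) and (R4) add and drop components only at the end, so an arbitrary selection of components
-- has to become an initial segment of a permutation. The induction removes the point `ι zero` from
-- the target, completes the remaining injection, and lets `insert` send `zero` to that point.
extend-injection : (ι : Fin k → Fin m) → Injective _≡_ _≡_ ι →
                   ∃ λ r → ∃ λ (π : Permutation (k + r) m) →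
                   ∀ i → π ⟨$⟩ʳ (i ↑ˡ r) ≡ ι i
extend-injection {zero}  {m}     ι inj = m , id , λ ()
extend-injection {suc k} {zero}  ι inj with () ← ι zero
extend-injection {suc k} {suc m} ι inj with extend-injection ι′ ι′-injective
  where
  ι₀≢ : ∀ i → ι zero ≢ ι (suc i)
  ι₀≢ i = 0≢1+n ∘ inj

  ι′ : Fin k → Fin m
  ι′ i = punchOut (ι₀≢ i)

  ι′-injective : Injective _≡_ _≡_ ι′
  ι′-injective {i} {j} = Fin-suc-injective ∘ inj ∘ punchOut-injective (ι₀≢ i) (ι₀≢ j)
... | r , π , π≗ι′ = r , insert zero (ι zero) π , λ where
  zero    → refl
  (suc i) → trans (insert-punchIn zero (ι zero) π (i ↑ˡ r))
              (trans (cong (punchIn (ι zero)) (π≗ι′ i)) (punchIn-punchOut _))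

-- Unfolds to `permute π` when `ι` is `π ⟨$⟩ʳ_`, so the lemmas about it apply directly to (R1).
reindex : (Fin k → Fin m) → Vec X m → Vec X k
reindex ι xs = tabulate (lookup xs ∘ ι)

map-reindex : (f : X → Y) (ι : Fin k → Fin m) (xs : Vec X m) →
              map f (reindex ι xs) ≡ reindex ι (map f xs)
map-reindex f ι xs =
  trans (sym (tabulate-∘ f _)) (tabulate-cong λ i → sym (lookup-map (ι i) f xs))

reindex-unique : (ι : Fin k → Fin m) → Injective _≡_ _≡_ ι →
                 {xs : Vec X m} → Unique xs → Unique (reindex ι xs)
reindex-unique ι inj d = tabulate⁺ λ eq → inj (lookup-injective d _ _ eq)

reindex-inverse : (ι : Fin k → Fin m) (κ : Fin m → Fin k) → (∀ i → ι (κ i) ≡ i) →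
                  (xs : Vec X m) → reindex κ (reindex ι xs) ≡ xs
reindex-inverse ι κ ικ≗id xs = trans
  (tabulate-cong λ i → trans (lookup∘tabulate _ (κ i)) (cong (lookup xs) (ικ≗id i)))
  (tabulate∘lookup xs)

take-tabulate : ∀ k (f : Fin (k + r) → X) → take k (tabulate f) ≡ tabulate (f ∘ (_↑ˡ r))
take-tabulate zero    f = refl
take-tabulate (suc k) f = cong (f zero ∷_) (take-tabulate k (f ∘ suc))

take-reindex : (ι : Fin k → Fin m) (π : Fin (k + r) → Fin m) →
               (∀ i → π (i ↑ˡ r) ≡ ι i) →
               (xs : Vec X m) → take k (reindex π xs) ≡ reindex ι xs
take-reindex {k} ι π π≗ι xs =
  trans (take-tabulate k _) (tabulate-cong λ i → cong (lookup xs) (π≗ι i))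

take-++ : (xs : Vec X k) (ys : Vec X r) → take k (xs ++ ys) ≡ xs
take-++ {k = k} xs ys = ++-injectiveˡ _ xs (take++drop≡id k (xs ++ ys))

⊆⇒reindex : (xs : Vec X k) (ys : Vec X m) → (∀ {x} → x ∈ᵛ xs → x ∈ᵛ ys) →
            ∃ λ ι → reindex ι ys ≡ xs
⊆⇒reindex xs ys xs⊆ys = ι , trans
  (tabulate-cong λ i → sym (lookup-index (mem i))) (tabulate∘lookup xs)
  where
  mem : ∀ i → lookup xs i ∈ᵛ ys
  mem i = xs⊆ys (∈-lookup i xs)

  ι : Fin _ → Fin _
  ι i = index (mem i)

-- The distinctness proof is irrelevant, as in `Sentence`; decidable equality on `Fin` turns the
-- irrelevant equation obtained from it into a usable one.
reindex-injective : (ι : Fin k → Fin m) (xs : Vec X m) →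
                    .(Unique (reindex ι xs)) → Injective _≡_ _≡_ ι
reindex-injective ι xs d {i} {j} ιi≡ιj = recompute (i ≟ j)
  (lookup-injective d i j (trans (lookup∘tabulate _ i)
    (trans (cong (lookup xs) ιi≡ιj) (sym (lookup∘tabulate _ j)))))

fromList-unique : {xs : List X} → List.Unique xs → Unique (fromList xs)
fromList-unique []         = []
fromList-unique (px ∷ pxs) = fromList⁺ px ∷ fromList-unique pxs

module _ {𝓛 : Logic} where
  open Logic 𝓛

  -- Soundness.

  values : Model 𝓛 → Vec (Formula 𝓛) k → Vec 𝕀 k
  values M = map (λ σ → ⟦ σ ⟧ M)

  -- Evaluation applies the same `f₂` and `f₁` that `Respects` mentions; this is the soundness of
  -- (R6w).
  values-respects : (M : Model 𝓛) (σs : Vec (Formula 𝓛) k) → values M σs ∈ Respects σs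
  values-respects M σs =
      (λ m i j α w₁ w₂ eq → trans
        (cong₂ (λ x y → f₂ α x y w₁ w₂) (lookup-map i _ σs) (lookup-map j _ σs))
        (trans (cong (λ σ → ⟦ σ ⟧ M) (sym eq)) (sym (lookup-map m _ σs))))
    , (λ j i ρ w eq → trans
        (cong (λ x → f₁ ρ x w) (lookup-map i _ σs))
        (trans (cong (λ σ → ⟦ σ ⟧ M) (sym eq)) (sym (lookup-map j _ σs))))

  sound : ∀ {Γ : List (Sentence 𝓛)} {γ} → Γ ⊢ γ → Γ ⊨ γ
  sound (hyp γ∈Γ) M M⊩Γ = All.lookup M⊩Γ γ∈Γ
  sound (A σ d) M M⊩Γ = tt
  sound (R1 {σs = σs} π d′ D) M M⊩Γ =
    values M σs , sound D M M⊩Γ , map-reindex _ (π ⟨$⟩ʳ_) σs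
  sound (R2 {n} {σs = σs} {S} τs d′ D) M M⊩Γ = subst S
    (sym (trans (cong (take (suc n)) (map-++ _ σs τs)) (take-++ (values M σs) (values M τs))))
    (sound D M M⊩Γ)
  sound (R3 D₁ D₂) M M⊩Γ = sound D₁ M M⊩Γ , sound D₂ M M⊩Γ
  sound (R4 σs τs {S} d′ D) M M⊩Γ =
    values M τs , subst S (map-++ _ σs τs) (sound D M M⊩Γ)
  sound (R5 S⊆S′ D) M M⊩Γ = S⊆S′ (sound D M M⊩Γ)
  sound (R6w {σs = σs} D) M M⊩Γ = sound D M M⊩Γ , values-respects M σs

  -- Derived rules for changing the list of formulas of a sentence.

  rename-formulas : ∀ {Γ : List (Sentence 𝓛)} {σs τs : Vec (Formula 𝓛) (suc n)} {S}
                    .{d : Unique σs} .{d′ : Unique τs} → σs ≡ τs →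
                    Γ ⊢ sentence σs d S → Γ ⊢ sentence τs d′ S
  rename-formulas refl D = D

  -- (R2) appends the components of `τs` outside the image of `ι`, (R1) with the inverse permutation
  -- restores the order of `τs`, and (R5) passes from the image set produced by (R1) to the preimage
  -- under `reindex ι`.
  extend : ∀ {Γ : List (Sentence 𝓛)} {σs : Vec (Formula 𝓛) (suc n)}
           {τs : Vec (Formula 𝓛) (suc m)} {S} .{d : Unique σs} .{d′ : Unique τs}
           (ι : Fin (suc n) → Fin (suc m)) → reindex ι τs ≡ σs →
           Γ ⊢ sentence σs d S → Γ ⊢ sentence τs d′ (λ t → reindex ι t ∈ S)
  extend {n} {τs = τs} {S} {d} {d′} ι refl D
    with extend-injection ι (reindex-injective ι τs d)
  -- The bijection forces `n + r ≡ m`; matching on it makes `π` a permutation of one index set, as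
  -- (R1) requires.
  ... | r , π , π≗ι with suc-injective (↔⇒≡ π)
  ...   | refl = R5 back (rename-formulas permuted≡
      (R1 (flip π) (subst Unique (sym permuted≡) d′)
        (R2 ρs (subst Unique (sym ++≡) (reindex-unique _ (Injection.injective (↔⇒↣ π)) d′)) D)))
    where
    ρs : Vec (Formula 𝓛) r
    ρs = drop (suc n) (permute π τs)

    ++≡ : reindex ι τs ++ ρs ≡ permute π τs
    ++≡ = trans (cong (_++ ρs) (sym (take-reindex ι (π ⟨$⟩ʳ_) π≗ι τs)))
            (take++drop≡id (suc n) (permute π τs))

    permuted≡ : permute (flip π) (reindex ι τs ++ ρs) ≡ τs
    permuted≡ = trans (cong (permute (flip π)) ++≡)
                  (reindex-inverse (π ⟨$⟩ʳ_) (π ⟨$⟩ˡ_) (λ _ → inverseʳ π) τs)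

    back : ∀ {t} → (∃ λ s → take (suc n) s ∈ S × t ≡ permute (flip π) s) → reindex ι t ∈ S
    back (s , s∈S , refl) = subst S (sym (trans
      (sym (take-reindex ι (π ⟨$⟩ʳ_) π≗ι (permute (flip π) s)))
      (cong (take (suc n)) (reindex-inverse (π ⟨$⟩ˡ_) (π ⟨$⟩ʳ_) (λ _ → inverseˡ π) s)))) s∈S

  -- Opposite to `extend`: (R1) moves the components selected by `ι` to the front and (R4) projects
  -- the others away.
  restrict : ∀ {Γ : List (Sentence 𝓛)} {σs : Vec (Formula 𝓛) (suc n)}
             {τs : Vec (Formula 𝓛) (suc m)} {S} .{d : Unique σs} .{d′ : Unique τs}
             (ι : Fin (suc n) → Fin (suc m)) → reindex ι τs ≡ σs →
             Γ ⊢ sentence τs d′ S →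
             Γ ⊢ sentence σs d (λ s → ∃ λ t → t ∈ S × s ≡ reindex ι t)
  restrict {n} {τs = τs} {S} {d} {d′} ι refl D
    with extend-injection ι (reindex-injective ι τs d)
  -- (R4) must drop at least one component, so a bijective ι is treated apart.
  ... | zero , π , π≗ι
    with suc-injective (trans (sym (+-identityʳ (suc n))) (↔⇒≡ π))
  ...   | refl = R5 back (rename-formulas (same τs)
      (R1 π′ (subst Unique (sym (same τs)) d) D))
    where
    π′ : Permutation (suc n) (suc n)
    π′ = cast-id (sym (+-identityʳ (suc n))) ∘ₚ π

    π′≗ι : ∀ i → π′ ⟨$⟩ʳ i ≡ ι i
    π′≗ι i = trans (cong (π ⟨$⟩ʳ_) (toℕ-injective
      (trans (toℕ-cast _ i) (sym (toℕ-↑ˡ i 0))))) (π≗ι i)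

    same : (xs : Vec X (suc n)) → permute π′ xs ≡ reindex ι xs
    same xs = tabulate-cong λ i → cong (lookup xs) (π′≗ι i)

    back : ∀ {s} → (∃ λ t → t ∈ S × s ≡ permute π′ t) → ∃ λ t → t ∈ S × s ≡ reindex ι t
    back (t , t∈S , eq) = t , t∈S , trans eq (same t)
  restrict {n} {τs = τs} {S} {d} {d′} ι refl D | suc r , π , π≗ι with suc-injective (↔⇒≡ π)
  ...   | refl = R5 back (R4 (reindex ι τs) ρs
      {d = subst Unique (sym ++≡) (reindex-unique _ (Injection.injective (↔⇒↣ π)) d′)} d
      (rename-formulas (sym ++≡) (R1 π (reindex-unique _ (Injection.injective (↔⇒↣ π)) d′) D)))
    where
    ρs : Vec (Formula 𝓛) (suc r)
    ρs = drop (suc n) (permute π τs)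

    ++≡ : reindex ι τs ++ ρs ≡ permute π τs
    ++≡ = trans (cong (_++ ρs) (sym (take-reindex ι (π ⟨$⟩ʳ_) π≗ι τs)))
            (take++drop≡id (suc n) (permute π τs))

    back : ∀ {s} → (∃ λ t → ∃ λ u → u ∈ S × s ++ t ≡ permute π u) →
           ∃ λ u → u ∈ S × s ≡ reindex ι u
    back {s} (t , u , u∈S , eq) = u , u∈S , trans (sym (take-++ s t))
      (trans (cong (take (suc n)) eq) (take-reindex ι (π ⟨$⟩ʳ_) π≗ι u))

  -- Subformulas and finite subformula-closed lists.

  -- Splitting off the proper subformulas makes `σ` the head of its own list without a case
  -- distinction on `σ`, so reflexivity is `here refl`.
  subformulas : Formula 𝓛 → List (Formula 𝓛)
  properSubformulas : Formula 𝓛 → List (Formula 𝓛)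

  subformulas σ = σ ∷ properSubformulas σ

  properSubformulas (atom a)               = []
  properSubformulas (binary α σ₁ σ₂ w₁ w₂) = subformulas σ₁ List.++ subformulas σ₂
  properSubformulas (unary ρ σ w)          = subformulas σ

  subformulas-trans : ∀ {σ τ υ} → τ ∈ˡ subformulas σ → υ ∈ˡ subformulas τ →
                      υ ∈ˡ subformulas σ
  subformulas-trans (here refl) υ∈ = υ∈
  subformulas-trans {binary α σ₁ σ₂ w₁ w₂} (there τ∈) υ∈ with ∈ˡ-++⁻ (subformulas σ₁) τ∈
  ... | inj₁ τ∈₁ = there (∈ˡ-++⁺ˡ (subformulas-trans τ∈₁ υ∈))
  ... | inj₂ τ∈₂ = there (∈ˡ-++⁺ʳ (subformulas σ₁) (subformulas-trans τ∈₂ υ∈))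
  subformulas-trans {unary ρ σ w} (there τ∈) υ∈ = there (subformulas-trans τ∈ υ∈)

  SubformulaClosed : Vec (Formula 𝓛) k → Set
  SubformulaClosed τs = ∀ {σ τ} → σ ∈ᵛ τs → τ ∈ˡ subformulas σ → τ ∈ᵛ τs

  subformula-closure : ExcludedMiddle 0ℓ → ∀ σ (σs : List (Formula 𝓛)) →
    ∃ λ n → ∃ λ (τs : Vec (Formula 𝓛) (suc n)) →
    Unique τs × (∀ {τ} → τ ∈ˡ σ ∷ σs → τ ∈ᵛ τs) × SubformulaClosed τs
  subformula-closure em σ σs =
    _ , fromList (deduplicate _≟ᶠ_ τs) , fromList-unique (Dedup.deduplicate-! _≟ᶠ_ τs)
      , (λ τ∈ → collect τ∈ (here refl)) , closed
    where
    -- Formulas carry real weights, which are functions on `ℚ`, so equality is decided by `em`.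
    _≟ᶠ_ : DecidableEquality (Formula 𝓛)
    _ ≟ᶠ _ = em

    τs : List (Formula 𝓛)
    τs = concatMap subformulas (σ ∷ σs)

    collect : ∀ {υ τ} → υ ∈ˡ σ ∷ σs → τ ∈ˡ subformulas υ →
              τ ∈ᵛ fromList (deduplicate _≟ᶠ_ τs)
    collect υ∈ τ∈υ = ∈-fromList⁺ (∈-deduplicate⁺ _≟ᶠ_ {xs = τs}
      (∈-concatMap⁺ subformulas {xs = σ ∷ σs} (lose υ∈ τ∈υ)))

    closed : SubformulaClosed (fromList (deduplicate _≟ᶠ_ τs))
    closed σ∈ τ∈σ
      with find (∈-concatMap⁻ subformulas {xs = σ ∷ σs}
             (∈-deduplicate⁻ _≟ᶠ_ τs (∈-fromList⁻ σ∈)))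
    ... | υ , υ∈ , σ∈υ = collect υ∈ (subformulas-trans σ∈υ τ∈σ)

  -- Completeness.

  -- The atoms among `τs` determine `M`, and `truth` goes by induction on the formula: closure
  -- places the immediate subformulas in `τs`, where `Respects` supplies the equation for the
  -- connective.
  respecting⇒values : ExcludedMiddle 0ℓ → {τs : Vec (Formula 𝓛) (suc n)} →
                      Unique τs → SubformulaClosed τs →
                      ∀ {t} → t ∈ Respects τs → ∃ λ M → values M τs ≡ t
  respecting⇒values em {τs} τs! closed {t} (resp₂ , resp₁) = M ,
    trans (sym (tabulate∘lookup (values M τs)))
      (trans (tabulate-cong λ i →
          trans (lookup-map i (λ σ → ⟦ σ ⟧ M) τs) (truth (lookup τs i) refl))
        (tabulate∘lookup t))
    where
    M : Model 𝓛
    M a with em {∃ λ i → lookup τs i ≡ atom a}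
    ... | yes (i , _) = lookup t i
    -- An atom outside `τs` may take any value; a coordinate of the nonempty `t` is at hand.
    ... | no _        = lookup t zero

    position : ∀ {i σ τ} → lookup τs i ≡ σ → τ ∈ˡ subformulas σ → ∃ λ j → lookup τs j ≡ τ
    position {i} refl τ∈ = _ , sym (lookup-index (closed (∈-lookup i τs) τ∈))

    truth : ∀ σ {i} → lookup τs i ≡ σ → ⟦ σ ⟧ M ≡ lookup t i
    truth (atom a) {i} eq with em {∃ λ i → lookup τs i ≡ atom a}
    -- The position `j` chosen by `em` need not be `i` a priori; distinctness of `τs` identifies
    -- them.
    ... | yes (j , eq′) = cong (lookup t) (lookup-injective τs! j i (trans eq′ (sym eq)))
    ... | no ∄          = contradiction (i , eq) ∄
    truth (binary α σ₁ σ₂ w₁ w₂) {i} eq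
      with position eq (there (∈ˡ-++⁺ˡ {xs = subformulas σ₁} (here refl)))
         | position eq (there (∈ˡ-++⁺ʳ (subformulas σ₁) (here refl)))
    -- Matching replaces `σ₁` and `σ₂` by entries of `τs`, which gives `eq` the shape that `resp₂`
    -- expects.
    ... | j , refl | k , refl = trans
      (cong₂ (λ x y → f₂ α x y w₁ w₂) (truth _ {j} refl) (truth _ {k} refl))
      (resp₂ i j k α w₁ w₂ eq)
    truth (unary ρ σ w) {i} eq with position eq (there (here refl))
    ... | j , refl = trans (cong (λ x → f₁ ρ x w) (truth _ {j} refl)) (resp₁ i j ρ w eq)

  -- The conjunction of the sentences of Δ cannot be written as All (M ⊩_) Δ,
  -- which is too large for a set of values; it is built by recursion instead.
  conjunction : ∀ {Γ} (τs : Vec (Formula 𝓛) (suc n)) .(d : Unique τs) (Δ : List (Sentence 𝓛)) →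
    (∀ {δ} → δ ∈ˡ Δ → Γ ⊢ δ) →
    (∀ {δ σ} → δ ∈ˡ Δ → σ ∈ᵛ Sentence.formulas δ → σ ∈ᵛ τs) →
    ∃ λ S → Γ ⊢ sentence τs d S × (∀ {M} → values M τs ∈ S → All (M ⊩_) Δ)
  conjunction τs d [] ⊢Δ Δ⊆ =
    -- With no hypotheses some sentence over `τs` must still be derived: (A) for the first formula,
    -- extended to `τs`, imposes no constraint.
    _ , extend (λ _ → zero) refl (A (lookup τs zero) ([] ∷ [])) , λ _ → []
  conjunction τs d (sentence σs _ S ∷ Δ) ⊢Δ Δ⊆
    with conjunction τs d Δ (⊢Δ ∘ there) (Δ⊆ ∘ there) | ⊆⇒reindex σs τs (Δ⊆ (here refl))
  ... | S′ , D , S′⇒Δ | ι , eq = _ , R3 (extend ι eq (⊢Δ (here refl))) D ,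
    λ {M} (∈S , ∈S′) →
      subst S (trans (sym (map-reindex _ ι τs)) (cong (values M) eq)) ∈S ∷ S′⇒Δ ∈S′

  complete : ExcludedMiddle 0ℓ → ∀ {Γ : List (Sentence 𝓛)} {γ} → Γ ⊨ γ → Γ ⊢ γ
  complete em {Γ} {γ@(sentence (σ ∷ σs) d S)} Γ⊨γ
    -- The first component of `γ` keeps the list nonempty even when `Γ` is empty.
    with subformula-closure em σ (toList σs List.++ concatMap (toList ∘ Sentence.formulas) Γ)
  ... | _ , τs , τs! , ⊆τs , closed
    with conjunction τs τs! Γ hyp (λ δ∈ σ∈ → ⊆τs (there (∈ˡ-++⁺ʳ (toList σs)
           (∈-concatMap⁺ (toList ∘ Sentence.formulas) (lose δ∈ (∈-toList⁺ σ∈))))))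
       | ⊆⇒reindex (σ ∷ σs) τs (⊆τs ∘ ∈ˡ-++⁺ˡ ∘ ∈-toList⁺)
  -- (R6w) comes before the projection, since it sees only connectives between listed formulas.
  ... | T , D , T⇒Γ | ι , eq = R5 T⊆S (restrict {d′ = τs!} ι eq (R6w D))
    where
    T⊆S : ∀ {s} → (∃ λ t → t ∈ (T ∩ Respects τs) × s ≡ reindex ι t) → s ∈ S
    T⊆S (t , (t∈T , resp) , refl) with respecting⇒values em τs! closed {t} resp
    ... | M , refl = subst S (trans (cong (values M) (sym eq)) (map-reindex _ ι τs))
                       (Γ⊨γ M (T⇒Γ t∈T))

theorem5 : ExcludedMiddle 0ℓ →
    (𝓛 : Logic) (Γ : List (Sentence 𝓛)) (γ : Sentence 𝓛) →
    (Γ ⊢ γ) ⇔ (Γ ⊨ γ)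
theorem5 em 𝓛 Γ γ = mk⇔ sound (complete em)
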